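{- Each of the three graphs $P_4[2,2,1,2]$, $P_4[2,2,2,1]$ and $P_4[2,2,2,2]$ has a finite deletion host.
   Context: $P_4[a,b,c,d]$ denotes the graph obtained from the path on four vertices $v_1v_2v_3v_4$ by replacing the consecutive vertices $v_1,v_2,v_3,v_4$ with disjoint cliques of orders $a,b,c,d$ respectively and joining consecutive cliques completely (with no edges between cliques corresponding to nonadjacent path vertices). A finite deletion host for a graph $H$ is a finite simple graph $G$ such that $E(G)\neq\varnothing$, $G$ contains no induced subgraph isomorphic to $H$, and for every $e\in E(G)$ the graph $G-e$ (edge deleted, vertices kept) contains an induced subgraph isomorphic to $H$. -}

module Defs where

open import Level using (0ℓ)
open import Data.Nat using (ℕ; suc)
import Data.Nat.Properties as ℕ
open import Data.Fin using (Fin; toℕ)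
import Data.Fin.Properties as Fin
open import Data.Fin.Subset using (Subset; _∈_)
open import Data.Product using (Σ; Σ-syntax; ∃-syntax; _×_; _,_; proj₁)
open import Data.Product.Properties using (≡-dec)
open import Data.Sum using (_⊎_; inj₁; inj₂; swap; [_,_])
import Data.Sum as Sum
open import Data.Vec using (_∷_; []; lookup)
open import Function using (_∘_; _↔_; _⇔_; Inverse)
open import Relation.Binary
  using (Rel; Symmetric; Irreflexive; Decidable; DecidableEquality)
open import Relation.Binary.PropositionalEquality using (_≡_; _≢_; refl; sym)
open import Relation.Nullary using (¬_)
open import Relation.Nullary.Decidable using (_×-dec_; _⊎-dec_; ¬?)

record SimpleGraph (V : Set) : Set₁ where
  field
    Adj    : Rel V 0ℓ
    symm   : Symmetric Adj
    irrefl : Irreflexive _≡_ Adj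
    adj?   : Decidable Adj

open SimpleGraph

record _≅_ {V W : Set} (G : SimpleGraph V) (H : SimpleGraph W) : Set where
  field
    bijection : V ↔ W
    adj⇔      : ∀ u v → Adj G u v ⇔ Adj H (Inverse.to bijection u) (Inverse.to bijection v)

-- Membership in a Subset is proof-irrelevant, so the vertices of the induced
-- subgraph are exactly the elements of S, without repetition.
induce : ∀ {n} → SimpleGraph (Fin n) → (S : Subset n) → SimpleGraph (Σ[ v ∈ Fin n ] v ∈ S)
induce G S = record
  { Adj    = λ u v → Adj G (proj₁ u) (proj₁ v)
  ; symm   = symm G
  ; irrefl = λ { refl → irrefl G refl }
  ; adj?   = λ u v → adj? G (proj₁ u) (proj₁ v)
  }

ContainsInduced : ∀ {n} {W : Set} → SimpleGraph (Fin n) → SimpleGraph W → Set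
ContainsInduced {n} G H = ∃[ S ] (H ≅ induce {n} G S)

-- {x , y} = {u , v} as unordered pairs.
SamePair : {V : Set} → V → V → V → V → Set
SamePair u v x y = (x ≡ u × y ≡ v) ⊎ (x ≡ v × y ≡ u)

deleteEdge : ∀ {n} → SimpleGraph (Fin n) → Fin n → Fin n → SimpleGraph (Fin n)
deleteEdge G u v = record
  { Adj    = λ x y → Adj G x y × ¬ SamePair u v x y
  ; symm   = λ { (a , ne) → symm G a , ne ∘ flipPair }
  ; irrefl = λ { eq (a , _) → irrefl G eq a }
  ; adj?   = λ x y → adj? G x y ×-dec
               ¬? ((x Fin.≟ u ×-dec y Fin.≟ v) ⊎-dec (x Fin.≟ v ×-dec y Fin.≟ u))
  }
  where
  flipPair : ∀ {x y} → SamePair u v x y → SamePair u v y x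
  flipPair (inj₁ (p , q)) = inj₂ (q , p)
  flipPair (inj₂ (p , q)) = inj₁ (q , p)

record IsDeletionHost {W : Set} (H : SimpleGraph W) {n : ℕ} (G : SimpleGraph (Fin n)) : Set where
  field
    nonempty : ∃[ u ] ∃[ v ] Adj G u v
    free     : ¬ ContainsInduced G H
    deletion : ∀ u v → Adj G u v → ContainsInduced (deleteEdge G u v) H

HasFiniteDeletionHost : {W : Set} → SimpleGraph W → Set₁
HasFiniteDeletionHost H = ∃[ n ] Σ[ G ∈ SimpleGraph (Fin n) ] IsDeletionHost H G

pathGraph : (n : ℕ) → SimpleGraph (Fin n)
pathGraph n = record
  { Adj    = λ i j → suc (toℕ i) ≡ toℕ j ⊎ suc (toℕ j) ≡ toℕ i
  ; symm   = swap
  ; irrefl = λ { refl → [ ℕ.1+n≢n , ℕ.1+n≢n ] }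
  ; adj?   = λ i j → (suc (toℕ i) ℕ.≟ toℕ j) ⊎-dec (suc (toℕ j) ℕ.≟ toℕ i)
  }

-- Replace each vertex i of G by a clique of order s i, joining the cliques of
-- adjacent vertices completely.
cliqueBlowup : ∀ {n} → SimpleGraph (Fin n) → (s : Fin n → ℕ) →
               SimpleGraph (Σ[ i ∈ Fin n ] Fin (s i))
cliqueBlowup {n} G s = record
  { Adj    = λ x y → x ≢ y × (proj₁ x ≡ proj₁ y ⊎ Adj G (proj₁ x) (proj₁ y))
  ; symm   = λ { (ne , a) → ne ∘ sym , Sum.map sym (symm G) a }
  ; irrefl = λ { eq (ne , _) → ne eq }
  ; adj?   = λ x y → ¬? (x ≟ y) ×-dec
               ((proj₁ x Fin.≟ proj₁ y) ⊎-dec adj? G (proj₁ x) (proj₁ y))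
  }
  where
  _≟_ : DecidableEquality (Σ[ i ∈ Fin n ] Fin (s i))
  _≟_ = ≡-dec Fin._≟_ Fin._≟_

P₄[_,_,_,_] : (a b c d : ℕ) →
              SimpleGraph (Σ[ i ∈ Fin 4 ] Fin (lookup (a ∷ b ∷ c ∷ d ∷ []) i))
P₄[ a , b , c , d ] = cliqueBlowup (pathGraph 4) (lookup (a ∷ b ∷ c ∷ d ∷ []))

{-# OPTIONS --safe #-}
module Submission where

-- The hosts are circulant graphs, found by computer search.  Rotations act
-- transitively on the vertices, so it suffices to refute by backtracking the
-- embeddings that send one fixed vertex to 0, and to exhibit an induced copy of
-- the blow-up after deleting each edge at 0.

open import Data.Bool using (Bool; true; T; _∧_)
open import Data.Bool.ListAction using (all; any)
open import Data.Bool.Properties as Bool using (T-≡; T-∧)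
open import Data.Fin using (Fin; zero; suc; toℕ; fromℕ; inject₁)
open import Data.Fin.Induction using (<-weakInduction; >-weakInduction)
import Data.Fin.Properties as Fin
open import Data.Fin.Relation.Unary.Top using (view; ‵fromℕ; ‵inject₁)
open import Data.Fin.Subset using (Subset; _∈_)
open import Data.List as List using (List; []; _∷_; concatMap; allFin; drop)
import Data.List.Membership.DecPropositional as ListMembership
open import Data.List.Membership.Propositional using (lose)
open import Data.List.Membership.Propositional.Properties using (∈-allFin)
import Data.List.Relation.Unary.All as All
import Data.List.Relation.Unary.All.Properties as All
open import Data.List.Relation.Unary.Any as Any using (Any)
import Data.List.Relation.Unary.Any.Properties as Any
open import Data.Nat using (ℕ; zero; suc; _*_; _∸_; ∣_-_∣)
open import Data.Nat.DivMod using (_mod_)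
import Data.Nat.Properties as ℕ
open import Data.Product using (Σ-syntax; ∃; ∃-syntax; _×_; _,_; proj₁; proj₂; uncurry)
open import Data.Product.Properties using (≡-dec)
open import Data.Sum as Sum using (_⊎_; inj₁; inj₂)
open import Data.Vec using (Vec; []; _∷_; lookup; tabulate)
open import Data.Vec.Membership.Propositional.Properties using (∈-lookup)
open import Data.Vec.Properties using (lookup∘tabulate; []=⇒lookup; lookup⇒[]=)
open import Data.Vec.Properties.WithK using ([]=-irrelevant)
open import Data.Vec.Relation.Unary.All as VecAll using ([]; _∷_)
open import Function using (_∘_; mk⇔; mk↔ₛ′; Inverse; Injection; Equivalence)
open import Function.Properties.Inverse using (↔⇒↣)
open import Level using (0ℓ)
open import Relation.Binary using (DecidableEquality)
open import Relation.Binary.PropositionalEquality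
  using (_≡_; _≢_; refl; sym; trans; cong; cong₂; subst)
open import Relation.Nullary using (¬_; Dec; isYes; contradiction)
open import Relation.Nullary.Decidable
  using (map′; toWitness; fromWitness; toWitnessFalse; ¬?; _×-dec_; _⊎-dec_; _→-dec_; True; False)
open import Relation.Unary using (Decidable; Pred)
open import Defs
open SimpleGraph

open ListMembership ℕ._≟_ using (_∈?_) renaming (_∈_ to _∈ˡ_)

private
  variable
    V W X : Set
    k m n : ℕ

-- Induced embeddings of graphs.

-- Being an induced embedding is a condition on pairs of vertices. Isolating it lets one decidable
-- test both prune partial maps in a search and verify complete ones.
LocallyEmbeds : SimpleGraph V → SimpleGraph W → V × W → V × W → Set
LocallyEmbeds G H (x , u) (y , v) =
  (u ≡ v → x ≡ y) × (Adj G x y → Adj H u v) × (Adj H u v → Adj G x y)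

record _↪_ (G : SimpleGraph V) (H : SimpleGraph W) : Set where
  field
    to            : V → W
    locallyEmbeds : ∀ x y → LocallyEmbeds G H (x , to x) (y , to y)

  injective : ∀ {x y} → to x ≡ to y → x ≡ y
  injective = proj₁ (locallyEmbeds _ _)

  preserves : ∀ {x y} → Adj G x y → Adj H (to x) (to y)
  preserves = proj₁ (proj₂ (locallyEmbeds _ _))

  reflects : ∀ {x y} → Adj H (to x) (to y) → Adj G x y
  reflects = proj₂ (proj₂ (locallyEmbeds _ _))

open _↪_

↪-trans : {F : SimpleGraph V} {G : SimpleGraph W} {H : SimpleGraph X} →
          F ↪ G → G ↪ H → F ↪ H
↪-trans f g = record
  { to            = to g ∘ to f
  ; locallyEmbeds = λ _ _ →
      injective f ∘ injective g , preserves g ∘ preserves f , reflects f ∘ reflects g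
  }

-- Injectivity of `σ` ensures that an edge is sent to the removed edge only if it is itself the
-- removed one.
↪-deleteEdge : {G : SimpleGraph (Fin m)} {H : SimpleGraph (Fin n)} (σ : G ↪ H) →
               ∀ u v → deleteEdge G u v ↪ deleteEdge H (to σ u) (to σ v)
↪-deleteEdge σ u v = record
  { to            = to σ
  ; locallyEmbeds = λ _ _ →
        injective σ
      , (λ (a , ne) → preserves σ a , ne ∘ Sum.map pullback pullback)
      , (λ (a , ne) → reflects σ a , ne ∘ Sum.map pushforward pushforward)
  }
  where
  pullback : ∀ {x y p q} → to σ x ≡ to σ p × to σ y ≡ to σ q → x ≡ p × y ≡ q
  pullback (e , f) = injective σ e , injective σ f

  pushforward : ∀ {x y p q} → x ≡ p × y ≡ q → to σ x ≡ to σ p × to σ y ≡ to σ q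
  pushforward (e , f) = cong (to σ) e , cong (to σ) f

containsInduced⇒↪ : {H : SimpleGraph W} {G : SimpleGraph (Fin n)} → ContainsInduced G H → H ↪ G
containsInduced⇒↪ (_ , iso) = record
  { to            = proj₁ ∘ Inverse.to bijection
  ; locallyEmbeds = λ x y →
        (λ e → Injection.injective (↔⇒↣ bijection) (vertex-≡ e))
      , Equivalence.to (adj⇔ x y)
      , Equivalence.from (adj⇔ x y)
  }
  where
  open _≅_ iso
  vertex-≡ : ∀ {S : Subset _} {p q : Σ[ v ∈ Fin _ ] v ∈ S} → proj₁ p ≡ proj₁ q → p ≡ q
  vertex-≡ {p = v , _} refl = cong (v ,_) ([]=-irrelevant _ _)

-- Embeddings of blow-ups, and their exhaustive search.

BlowupVertex : (Fin k → ℕ) → Set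
BlowupVertex {k} s = Σ[ i ∈ Fin k ] Fin (s i)

module _ {s : Fin k → ℕ} where

  _≟ᵛ_ : DecidableEquality (BlowupVertex s)
  _≟ᵛ_ = ≡-dec Fin._≟_ Fin._≟_

  anyVertex? : {P : Pred (BlowupVertex s) 0ℓ} → Decidable P → Dec (∃ P)
  anyVertex? P? = map′ (λ (i , j , p) → (i , j) , p) (λ ((i , j) , p) → i , j , p)
    (Fin.any? λ i → Fin.any? λ j → P? (i , j))

  allVertices? : {P : Pred (BlowupVertex s) 0ℓ} → Decidable P → Dec (∀ x → P x)
  allVertices? P? = map′ uncurry (λ p i j → p (i , j))
    (Fin.all? λ i → Fin.all? λ j → P? (i , j))

  vertices : List (BlowupVertex s)
  vertices = concatMap (λ i → List.map (i ,_) (allFin (s i))) (allFin k)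

  -- The image of `f` serves as the vertex subset, and the inverse bijection comes from a finite
  -- search for preimages.
  ↪⇒containsInduced : {H : SimpleGraph (BlowupVertex s)} {G : SimpleGraph (Fin n)} →
                      H ↪ G → ContainsInduced G H
  ↪⇒containsInduced {n = n} {H} {G} f = image , record
    { bijection = mk↔ₛ′ (λ x → to f x , ∈-image x) (proj₁ ∘ preimage) to-from from-to
    ; adj⇔      = λ _ _ → mk⇔ (preserves f) (reflects f)
    }
    where
    hit? : ∀ v → Dec (∃[ x ] to f x ≡ v)
    hit? v = anyVertex? λ x → to f x Fin.≟ v

    image : Subset n
    image = tabulate (isYes ∘ hit?)

    ∈-image : ∀ x → to f x ∈ image
    ∈-image x = lookup⇒[]= _ image
      (trans (lookup∘tabulate (isYes ∘ hit?) _) (Equivalence.to T-≡ (fromWitness (x , refl))))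

    -- Membership in `image` is only a Boolean fact. The decision procedure `hit?` that produced it
    -- returns the actual preimage.
    preimage : (p : Σ[ v ∈ Fin n ] v ∈ image) → ∃[ x ] to f x ≡ proj₁ p
    preimage (v , v∈) = toWitness {a? = hit? v}
      (Equivalence.from T-≡ (trans (sym (lookup∘tabulate (isYes ∘ hit?) v)) ([]=⇒lookup v∈)))

    to-from : ∀ p → (to f (proj₁ (preimage p)) , ∈-image (proj₁ (preimage p))) ≡ p
    to-from p@(v , v∈) with preimage p
    ... | x , refl = cong (to f x ,_) ([]=-irrelevant _ _)

    from-to : ∀ x → proj₁ (preimage (to f x , ∈-image x)) ≡ x
    from-to x = injective f (proj₂ (preimage (to f x , ∈-image x)))

  module _ (H : SimpleGraph (BlowupVertex s)) (G : SimpleGraph (Fin n)) where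

    locallyEmbeds? : ∀ p q → Dec (LocallyEmbeds H G p q)
    locallyEmbeds? (x , u) (y , v) =
      ((u Fin.≟ v) →-dec (x ≟ᵛ y)) ×-dec
      (adj? H x y →-dec adj? G u v) ×-dec
      (adj? G u v →-dec adj? H x y)

    Embeds : (BlowupVertex s → Fin n) → Set
    Embeds f = ∀ x y → LocallyEmbeds H G (x , f x) (y , f y)

    embeds? : Decidable Embeds
    embeds? f = allVertices? λ x → allVertices? λ y → locallyEmbeds? (x , f x) (y , f y)

    -- Boolean rather than Dec-valued: the proof components of a Dec would keep
    -- the whole search tree in memory.
    extendable : List (BlowupVertex s × Fin n) → List (BlowupVertex s) → Bool
    extendable placed []       = true
    extendable placed (x ∷ xs) =
      any (λ v → all (isYes ∘ locallyEmbeds? (x , v)) placed ∧ extendable ((x , v) ∷ placed) xs)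
          (allFin n)

    -- At each step the search may choose the value of `f` itself, which passes every pairwise test.
    -- A failed search therefore refutes all embeddings extending the initial placement.
    ↪⇒extendable : (f : H ↪ G) → ∀ ys xs → T (extendable (List.map (λ y → y , to f y) ys) xs)
    ↪⇒extendable f ys []       = _
    ↪⇒extendable f ys (x ∷ xs) = Any.any⁺ _ (lose (∈-allFin (to f x)) (Equivalence.from T-∧
      ( All.all⁻ _ (All.map⁺ (All.universal (λ y → fromWitness (locallyEmbeds f x y)) ys))
      , ↪⇒extendable f (x ∷ ys) xs)))

-- Circulant graphs and their rotations.

-- Allowing `n ∸ d` closes the connection set under negation modulo `n`, so `S` lists only one of
-- each pair of opposite residues.
Joined : ℕ → List ℕ → ℕ → Set
Joined n S d = d ∈ˡ S ⊎ n ∸ d ∈ˡ S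

joined-reflect : ∀ {S d e} → d ≡ n ∸ e → e ≡ n ∸ d → Joined n S d → Joined n S e
joined-reflect {S = S} p q = Sum.swap ∘ Sum.map (subst (_∈ˡ S) p) (subst (_∈ˡ S) (sym q))

circulant : ∀ n → List ℕ → SimpleGraph (Fin n)
circulant n S = record
  { Adj    = λ i j → i ≢ j × Joined n S ∣ toℕ i - toℕ j ∣
  ; symm   = λ {i} {j} (ne , a) →
      ne ∘ sym , subst (Joined n S) (ℕ.∣-∣-comm (toℕ i) (toℕ j)) a
  ; irrefl = λ e (ne , _) → ne e
  ; adj?   = λ i j → ¬? (i Fin.≟ j) ×-dec
      ((∣ toℕ i - toℕ j ∣ ∈? S) ⊎-dec (n ∸ ∣ toℕ i - toℕ j ∣ ∈? S))
  }

-- This is subtraction of 1 modulo `suc m`, written so that its clauses match the steps of weak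
-- induction on `Fin`.
rotate : Fin (suc m) → Fin (suc m)
rotate zero    = fromℕ _
rotate (suc i) = inject₁ i

rotate-injective : ∀ (i j : Fin (suc m)) → rotate i ≡ rotate j → i ≡ j
rotate-injective zero    zero    _ = refl
rotate-injective zero    (suc j) e = contradiction e Fin.fromℕ≢inject₁
rotate-injective (suc i) zero    e = contradiction (sym e) Fin.fromℕ≢inject₁
rotate-injective (suc i) (suc j) e = cong suc (Fin.inject₁-injective e)

rotate-surjective : ∀ (j : Fin (suc m)) → ∃[ i ] rotate i ≡ j
rotate-surjective j with view j
... | ‵fromℕ     = zero , refl
... | ‵inject₁ i = suc i , refl

-- Only a pair containing 0 can wrap around, which replaces the distance by its complement. Both
-- equations are recorded because subtraction is truncated.
rotate-distance : ∀ (i j : Fin (suc m)) →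
  let d  = ∣ toℕ i - toℕ j ∣
      d′ = ∣ toℕ (rotate i) - toℕ (rotate j) ∣
  in d′ ≡ d ⊎ (d′ ≡ suc m ∸ d × d ≡ suc m ∸ d′)
rotate-distance {m} zero    zero    = inj₁ (ℕ.∣n-n∣≡0 (toℕ (fromℕ m)))
rotate-distance {m} zero    (suc j)
  rewrite Fin.toℕ-fromℕ m | Fin.toℕ-inject₁ j | ℕ.m≤n⇒∣n-m∣≡n∸m (ℕ.<⇒≤ (Fin.toℕ<n j)) =
  -- The new distance is `m ∸ j`, which is `suc m ∸ suc j` by computation. The converse equation
  -- uses `j ≤ m`.
  inj₂ (refl , sym (trans (ℕ.+-∸-assoc 1 (ℕ.m∸n≤m m (toℕ j)))
                          (cong suc (ℕ.m∸[m∸n]≡n (ℕ.<⇒≤ (Fin.toℕ<n j))))))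
rotate-distance {m} (suc i) zero
  rewrite ℕ.∣-∣-comm (toℕ (inject₁ i)) (toℕ (fromℕ m)) = rotate-distance zero (suc i)
rotate-distance     (suc i) (suc j) =
  inj₁ (cong₂ ∣_-_∣ (Fin.toℕ-inject₁ i) (Fin.toℕ-inject₁ j))

module _ {m : ℕ} {S : List ℕ} where

  private
    C = circulant (suc m) S

  rotation : C ↪ C
  rotation = record
    { to            = rotate
    ; locallyEmbeds = λ i j →
          rotate-injective i j
        , (λ (ne , a) → ne ∘ rotate-injective i j , forth i j a)
        , (λ (ne , a) → ne ∘ cong rotate , back i j a)
    }
    where
    forth : ∀ i j → Joined (suc m) S ∣ toℕ i - toℕ j ∣ →
            Joined (suc m) S ∣ toℕ (rotate i) - toℕ (rotate j) ∣
    forth i j with rotate-distance i j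
    ... | inj₁ e       = subst (Joined (suc m) S) (sym e)
    ... | inj₂ (p , q) = joined-reflect q p

    back : ∀ i j → Joined (suc m) S ∣ toℕ (rotate i) - toℕ (rotate j) ∣ →
           Joined (suc m) S ∣ toℕ i - toℕ j ∣
    back i j with rotate-distance i j
    ... | inj₁ e       = subst (Joined (suc m) S) e
    ... | inj₂ (p , q) = joined-reflect p q

  -- Composing with `rotation` lowers the image of `x` by one, so any embedding yields one sending
  -- `x` to 0.
  circulant-free : {H : SimpleGraph W} (x : W) → (∀ (f : H ↪ C) → to f x ≢ zero) → ¬ (H ↪ C)
  circulant-free {H = H} x none f = go (to f x) f refl
    where
    go : ∀ v (f : H ↪ C) → to f x ≢ v
    go = <-weakInduction (λ v → ∀ (f : H ↪ C) → to f x ≢ v) none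
      λ i step f e → step (↪-trans f rotation) (cong rotate e)

  circulant-deletion : {H : SimpleGraph W} →
                       (∀ v → Adj C zero v → H ↪ deleteEdge C zero v) →
                       ∀ u v → Adj C u v → H ↪ deleteEdge C u v
  circulant-deletion {H = H} base =
    -- The first rotation carries 0 to the top vertex, and later ones descend from there through all
    -- vertices.
    >-weakInduction Deletable (rotate-deletable zero base) (λ i → rotate-deletable (suc i))
    where
    Deletable : Pred (Fin (suc m)) 0ℓ
    Deletable u = ∀ v → Adj C u v → H ↪ deleteEdge C u v

    rotate-deletable : ∀ u → Deletable u → Deletable (rotate u)
    rotate-deletable u h v a with rotate-surjective v
    ... | w , refl = ↪-trans (h w (reflects rotation a)) (↪-deleteEdge rotation u w)

-- Certificates for the deleted edges, and the three hosts.

-- There is one row of residues per clique, with one entry per vertex of the clique.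
Placement : Vec ℕ k → Set
Placement = VecAll.All (Vec ℕ)

scale : {sizes : Vec ℕ k} → Placement sizes → Fin (suc m) →
        BlowupVertex (lookup sizes) → Fin (suc m)
scale {m = m} {sizes} p v (i , j) =
  (toℕ v * lookup (VecAll.lookup p (∈-lookup i sizes)) j) mod suc m

module _ {sizes : Vec ℕ k} {H : SimpleGraph (BlowupVertex (lookup sizes))}
         (m : ℕ) (S : List ℕ) where

  private
    C = circulant (suc m) S

  -- Placements are normalised to the edge {0 , 1}: scaled by v, one placement
  -- fits the edges {0 , v} for all v in a coset of the multiplier group of C.
  DeletableBy : List (Placement sizes) → Fin (suc m) → Set
  DeletableBy ps v = Any (λ p → Embeds H (deleteEdge C zero v) (scale p v)) ps

  deletableBy? : ∀ ps → Dec (∀ v → Adj C zero v → DeletableBy ps v)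
  deletableBy? ps = Fin.all? λ v → adj? C zero v →-dec
    Any.any? (λ p → embeds? H (deleteEdge C zero v) (scale p v)) ps

  -- The host has order suc m, not m.
  circulantHost : ∀ x xs ps
                  {_ : True (Fin.any? (adj? C zero))}
                  {_ : False (extendable H C ((x , zero) ∷ []) xs Bool.≟ true)}
                  {_ : True (deletableBy? ps)} →
                  HasFiniteDeletionHost H
  circulantHost x xs ps {edge} {stuck} {deletable} = suc m , C , record
    { nonempty = zero , toWitness edge
    ; free     = circulant-free x
        (λ f e → toWitnessFalse stuck (Equivalence.to T-≡
          (subst (λ v → T (extendable H C ((x , v) ∷ []) xs)) e (↪⇒extendable H C f (x ∷ []) xs))))
        ∘ containsInduced⇒↪
    ; deletion = λ u v a → ↪⇒containsInduced (circulant-deletion fromPlacement u v a)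
    }
    where
    fromPlacement : ∀ v → Adj C zero v → H ↪ deleteEdge C zero v
    fromPlacement v a with Any.satisfied (toWitness deletable v a)
    ... | p , emb = record { to = scale p v ; locallyEmbeds = emb }

-- The side conditions are closed decidable statements, discharged by evaluation. The multipliers
-- preserving this circulant of order 19 are only 1 and -1, and the four placements serve `v` = ±2,
-- ±3, ±4, ±6 in turn.
host₂₂₁₂ : HasFiniteDeletionHost P₄[ 2 , 2 , 1 , 2 ]
host₂₂₁₂ = circulantHost 18 (2 ∷ 3 ∷ 4 ∷ 6 ∷ []) (zero , zero) (drop 1 vertices)
  ( ((0 ∷ 16 ∷ []) ∷ (17 ∷ 18 ∷ []) ∷ (1 ∷ []) ∷ (12 ∷ 4 ∷ []) ∷ [])
  ∷ ((0 ∷ 12 ∷ []) ∷ (17 ∷ 5 ∷ []) ∷ (3 ∷ []) ∷ (1 ∷ 8 ∷ []) ∷ [])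
  ∷ ((0 ∷ 18 ∷ []) ∷ (10 ∷ 9 ∷ []) ∷ (1 ∷ []) ∷ (16 ∷ 12 ∷ []) ∷ [])
  ∷ ((0 ∷ 6 ∷ []) ∷ (13 ∷ 7 ∷ []) ∷ (1 ∷ []) ∷ (11 ∷ 2 ∷ []) ∷ [])
  ∷ [])

-- Up to isomorphism the host is the complement of the cubic residue graph modulo 13. The cubes ±1,
-- ±5 act as multipliers; the first placement serves that coset and the second serves ±2, ±3.
host₂₂₂₁ : HasFiniteDeletionHost P₄[ 2 , 2 , 2 , 1 ]
host₂₂₂₁ = circulantHost 12 (1 ∷ 2 ∷ 3 ∷ 5 ∷ []) (zero , zero) (drop 1 vertices)
  ( ((0 ∷ 10 ∷ []) ∷ (2 ∷ 12 ∷ []) ∷ (1 ∷ 4 ∷ []) ∷ (6 ∷ []) ∷ [])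
  ∷ ((0 ∷ 12 ∷ []) ∷ (7 ∷ 8 ∷ []) ∷ (1 ∷ 2 ∷ []) ∷ (10 ∷ []) ∷ [])
  ∷ [])

-- The host is the Paley graph of order 29.
host₂₂₂₂ : HasFiniteDeletionHost P₄[ 2 , 2 , 2 , 2 ]
host₂₂₂₂ = circulantHost 28 (1 ∷ 4 ∷ 5 ∷ 6 ∷ 7 ∷ 9 ∷ 13 ∷ []) (zero , zero) (drop 1 vertices)
  ( ((0 ∷ 9 ∷ []) ∷ (4 ∷ 13 ∷ []) ∷ (17 ∷ 26 ∷ []) ∷ (1 ∷ 21 ∷ []) ∷ [])
  ∷ [])

proposition7p1 : HasFiniteDeletionHost P₄[ 2 , 2 , 1 , 2 ] ×
    HasFiniteDeletionHost P₄[ 2 , 2 , 2 , 1 ] ×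
    HasFiniteDeletionHost P₄[ 2 , 2 , 2 , 2 ]
proposition7p1 = host₂₂₁₂ , host₂₂₂₁ , host₂₂₂₂
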